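{- Let $D$ be an oriented graph missing $2$ disjoint stars. If the dependency digraph $\Delta$ of $D$ has no isolated vertex, then $D$ satisfies the second neighborhood conjecture, that is, there is a vertex $v\in V(D)$ with $d^+_D(v)\le d^{++}_D(v)$.
   Context: All digraphs are finite. An oriented graph is a digraph without loops and without digons (directed cycles of length two). Write $x\rightarrow y$ if $(x,y)$ is an arc. $N^+(v)$ is the set of out-neighbors of $v$ and $N^{++}(v)$ is the set of vertices at distance exactly $2$ from $v$ (reached from $v$ by a directed path of length 2 but not by one of length 0 or 1); $d^+(v)=|N^+(v)|$, $d^{++}(v)=|N^{++}(v)|$. For distinct vertices $x,y$ of $D$, $xy$ is a missing edge if neither $(x,y)$ nor $(y,x)$ is an arc of $D$. The missing graph of $D$ is the graph whose edges are the missing edges of $D$ and whose vertices are the vertices of $D$ that are not adjacent to all other vertices. A star of center $x$ is a graph whose edge set has the form $\{a_ix : i=1,\dots,k\}$ with $k\ge 1$, the $a_i$ distinct and different from $x$. $D$ is missing 2 disjoint stars if its missing graph is the union of two vertex-disjoint stars (equivalently, $D$ is obtained from a tournament by deleting the edges of two vertex-disjoint stars). Dependency digraph: for missing edges $e$ and $e'$ of $D$, $e$ loses to $e'$ if the endpoints can be named $e=x_1y_1$, $e'=x_2y_2$ so that $x_1\rightarrow x_2$, $y_2\notin N^+(x_1)\cup N^{++}(x_1)$, $y_1\rightarrow y_2$ and $x_2\notin N^+(y_1)\cup N^{++}(y_1)$. The dependency digraph $\Delta$ of $D$ has the missing edges of $D$ as vertices, and an arc $(e,e')$ whenever $e$ loses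 to $e'$ (digons in $\Delta$ are allowed). A vertex of $\Delta$ is isolated if it has in-degree $0$ and out-degree $0$ in $\Delta$. -}

module Defs where

open import Data.Fin.Base using (Fin)
open import Data.Fin.Properties using (_≟_; any?)
open import Data.Fin.Subset using (Subset; _∈_; _∉_; ⁅_⁆; _∪_; ∣_∣; Nonempty)
open import Data.Nat.Base using (ℕ)
open import Data.Product.Base using (Σ; ∃; ∃-syntax; _×_; proj₁)
open import Data.Sum.Base using (_⊎_)
open import Data.Vec.Base using (tabulate)
open import Level using (0ℓ)
open import Relation.Binary.Core using (Rel)
open import Relation.Binary.Definitions using (Decidable)
open import Relation.Binary.PropositionalEquality.Core using (_≡_; _≢_)
open import Relation.Nullary using (does; ¬_)
open import Relation.Nullary.Decidable using (¬?; _×-dec_)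
open import Relation.Unary as Unary using (Pred; _≐_)

private
  variable
    n : ℕ

-- Undirected edges are two-element subsets, so the order of the endpoints is
-- immaterial up to _≡_.
pair : Fin n → Fin n → Subset n
pair x y = ⁅ x ⁆ ∪ ⁅ y ⁆

comprehension : {P : Pred (Fin n) 0ℓ} → Unary.Decidable P → Subset n
comprehension P? = tabulate (λ x → does (P? x))

record OrientedGraph (n : ℕ) : Set₁ where
  infix 4 _⟶_ _⟶?_
  field
    _⟶_     : Rel (Fin n) 0ℓ
    _⟶?_    : Decidable _⟶_
    noLoop  : ∀ {x} → ¬ (x ⟶ x)
    noDigon : ∀ {x y} → x ⟶ y → ¬ (y ⟶ x)

  N⁺ : Fin n → Subset n
  N⁺ v = comprehension (λ w → v ⟶? w)

  AtDistance2 : Rel (Fin n) 0ℓ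
  AtDistance2 v w = v ≢ w × ¬ (v ⟶ w) × ∃[ u ] (v ⟶ u × u ⟶ w)

  atDistance2? : Decidable AtDistance2
  atDistance2? v w =
    ¬? (v ≟ w) ×-dec ¬? (v ⟶? w) ×-dec any? (λ u → (v ⟶? u) ×-dec (u ⟶? w))

  N⁺⁺ : Fin n → Subset n
  N⁺⁺ v = comprehension (atDistance2? v)

  d⁺ : Fin n → ℕ
  d⁺ v = ∣ N⁺ v ∣

  d⁺⁺ : Fin n → ℕ
  d⁺⁺ v = ∣ N⁺⁺ v ∣

  Adjacent : Rel (Fin n) 0ℓ
  Adjacent x y = x ⟶ y ⊎ y ⟶ x

  IsMissingEdge : Pred (Subset n) 0ℓ
  IsMissingEdge e = ∃[ x ] ∃[ y ] (e ≡ pair x y × x ≢ y × ¬ Adjacent x y)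

record Graph (n : ℕ) : Set₁ where
  field
    V : Pred (Fin n) 0ℓ
    E : Pred (Subset n) 0ℓ

open Graph

missingGraph : OrientedGraph n → Graph n
missingGraph D = record
  { V = λ v → ¬ (∀ w → w ≢ v → Adjacent v w)
  ; E = IsMissingEdge
  }
  where open OrientedGraph D

record Star (n : ℕ) : Set where
  field
    center        : Fin n
    leaves        : Subset n
    leaves≢∅      : Nonempty leaves
    center∉leaves : center ∉ leaves

  graph : Graph n
  graph = record
    { V = λ v → v ∈ ⁅ center ⁆ ∪ leaves
    ; E = λ e → ∃[ a ] (a ∈ leaves × e ≡ pair a center)
    }

_IsUnionOf_And_ : Graph n → Graph n → Graph n → Set
G IsUnionOf H And K = V G ≐ V H Unary.∪ V K × E G ≐ E H Unary.∪ E K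

MissingTwoDisjointStars : OrientedGraph n → Set
MissingTwoDisjointStars {n} D = Σ (Star n) λ S → Σ (Star n) λ T →
  V (Star.graph S) Unary.⊥ V (Star.graph T) ×
  missingGraph D IsUnionOf Star.graph S And Star.graph T

module DependencyDigraph (D : OrientedGraph n) where
  open OrientedGraph D

  Vertex : Set
  Vertex = ∃ IsMissingEdge

  infix 4 _losesTo_

  _losesTo_ : Rel Vertex 0ℓ
  e losesTo e′ = ∃[ x₁ ] ∃[ y₁ ] ∃[ x₂ ] ∃[ y₂ ]
    ( proj₁ e ≡ pair x₁ y₁ × proj₁ e′ ≡ pair x₂ y₂
    × x₁ ⟶ x₂ × y₂ ∉ N⁺ x₁ ∪ N⁺⁺ x₁
    × y₁ ⟶ y₂ × x₂ ∉ N⁺ y₁ ∪ N⁺⁺ y₁ )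

  Isolated : Pred Vertex 0ℓ
  Isolated e = (∀ e′ → ¬ (e′ losesTo e)) × (∀ e′ → ¬ (e losesTo e′))

{-# OPTIONS --safe #-}
module Submission where

-- Let x → y be the centres (if they are joined the other way, swap the stars).  Give every
-- missing edge a convenient orientation if it has one, and otherwise orient it towards its
-- centre; let ⇒ be the resulting completion of D, L a median order of ⇒ and f its last
-- vertex.  The Havet–Thomassé argument cuts L into segments, each followed by f or by a
-- vertex z that is neither in N⁺(f) nor reached from N⁺(f) by a forward arc.  In a segment,
-- N⁺(f) is contained in the out-neighbours of z, hence is at most as large as the set of
-- in-neighbours of z, and these are second neighbours of f in the completion.
--
-- Passing from the completion to D, f loses at most one second neighbour: x if f = y, and
-- otherwise y.  To make up for it, L is chosen, among the median orders, to put y before x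
-- if possible, and then to put x and y as late as possible.  If moving z to the front of a
-- segment left the number of forward arcs unchanged, this choice would be contradicted when
-- the lost vertex is in the segment; so there the out-neighbours of z are strictly fewer than
-- its in-neighbours, and f is the required vertex.

open import Data.Bool.Base using (Bool; true; false; if_then_else_)
open import Data.Empty using (⊥)
open import Data.Fin.Base using (Fin; zero; suc)
open import Data.Fin.Properties using (_≟_; any?)
open import Data.Fin.Subset using (_∈_; ⁅_⁆; ∣_∣)
open import Data.Fin.Subset.Properties using (x∈⁅x⁆; x∈⁅y⁆⇒x≡y; x∈p∪q⁻; x∈p∪q⁺)
open import Data.List.Base as List using (List; []; _∷_; [_]; _++_; map; length; allFin; initLast)
open import Data.List.Membership.Propositional using (find; lose) renaming (_∈_ to _∈ᴸ_)
open import Data.List.Membership.Propositional.Properties using (∈-++⁺ʳ; ∈-allFin)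
open import Data.List.Properties using (++-assoc; map-++; map-tabulate; length-++; length-tabulate)
open import Data.List.Relation.Binary.Permutation.Propositional using (_↭_; ↭-refl; ↭-sym; ↭-trans; ↭⇒↭ₛ)
open import Data.List.Relation.Binary.Permutation.Propositional.Properties using (map⁺; shift; ++⁺ˡ; ↭-length; ∈-resp-↭)
import Data.List.Relation.Binary.Permutation.Setoid.Properties as ↭ₛ
open import Data.List.Relation.Unary.All as All using (All; []; _∷_)
import Data.List.Relation.Unary.All.Properties as All
open import Data.List.Relation.Unary.AllPairs using ([]; _∷_)
open import Data.List.Relation.Unary.Any as Any using (Any; here; there)
import Data.List.Relation.Unary.Any.Properties as Any
open import Data.List.Relation.Unary.Unique.Propositional using (Unique)
open import Data.List.Relation.Unary.Unique.Propositional.Properties using (allFin⁺)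
open import Data.Nat.Base using (ℕ; zero; suc; _+_; _*_; _≤_; _<_; z≤n; s≤s)
open import Data.Nat.ListAction using (sum)
open import Data.Nat.ListAction.Properties using (sum-++; sum-↭)
open import Data.Nat.Properties hiding (_≟_)
open import Data.Nat.Tactic.RingSolver using (solve-∀)
open import Data.Product.Base using (∃; ∃-syntax; _×_; _,_; proj₁; proj₂)
open import Data.Sum.Base as Sum using (_⊎_; inj₁; inj₂; [_,_]′)
open import Data.Vec.Base using (tabulate)
open import Function.Base using (_∘_; flip)
open import Level using (0ℓ)
open import Relation.Binary.Core using (Rel)
open import Relation.Binary.Definitions using (Decidable)
open import Relation.Binary.PropositionalEquality
  using (_≡_; _≢_; refl; sym; trans; cong; cong₂; subst; subst₂; setoid; module ≡-Reasoning)
open import Relation.Nullary using (¬_; Dec; yes; no; does; contradiction)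
open import Relation.Nullary.Decidable using (¬?; _×-dec_; _⊎-dec_; decidable-stable)
open import Defs

private
  variable
    n : ℕ
    A P Q R : Set

-- Indicators and finite sums

⟦_⟧ : Dec P → ℕ
⟦ P? ⟧ = if does P? then 1 else 0

⟦⟧≡1 : (P? : Dec P) → P → ⟦ P? ⟧ ≡ 1
⟦⟧≡1 (yes _) p = refl
⟦⟧≡1 (no ¬p) p = contradiction p ¬p

⟦⟧≡0 : (P? : Dec P) → ¬ P → ⟦ P? ⟧ ≡ 0
⟦⟧≡0 (yes p) ¬p = contradiction p ¬p
⟦⟧≡0 (no _)  ¬p = refl

⟦⟧≤1 : (P? : Dec P) → ⟦ P? ⟧ ≤ 1
⟦⟧≤1 (yes _) = ≤-refl
⟦⟧≤1 (no _)  = z≤n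

⟦⟧-mono : (P? : Dec P) (Q? : Dec Q) → (P → Q) → ⟦ P? ⟧ ≤ ⟦ Q? ⟧
⟦⟧-mono (yes p) Q? f = ≤-reflexive (sym (⟦⟧≡1 Q? (f p)))
⟦⟧-mono (no _)  Q? f = z≤n

⟦⟧-⊎ : (P? : Dec P) (Q? : Dec Q) (R? : Dec R) → (P → Q ⊎ R) → ⟦ P? ⟧ ≤ ⟦ Q? ⟧ + ⟦ R? ⟧
⟦⟧-⊎ (no _)  Q? R? f = z≤n
⟦⟧-⊎ (yes p) Q? R? f with f p
... | inj₁ q = ≤-trans (≤-reflexive (sym (⟦⟧≡1 Q? q))) (m≤m+n _ _)
... | inj₂ r = ≤-trans (≤-reflexive (sym (⟦⟧≡1 R? r))) (m≤n+m _ _)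

∑ : (A → ℕ) → List A → ℕ
∑ f xs = sum (map f xs)

∑-++ : ∀ (f : A → ℕ) xs ys → ∑ f (xs ++ ys) ≡ ∑ f xs + ∑ f ys
∑-++ f xs ys = trans (cong sum (map-++ f xs ys)) (sum-++ (map f xs) (map f ys))

∑-↭ : ∀ (f : A → ℕ) {xs ys} → xs ↭ ys → ∑ f xs ≡ ∑ f ys
∑-↭ f = sum-↭ ∘ map⁺ f

∑-mono : ∀ {f g : A → ℕ} xs → (∀ {s} → s ∈ᴸ xs → f s ≤ g s) → ∑ f xs ≤ ∑ g xs
∑-mono []       f≤g = z≤n
∑-mono (s ∷ xs) f≤g = +-mono-≤ (f≤g (here refl)) (∑-mono xs (f≤g ∘ there))

∑-+ : ∀ (f g : A → ℕ) xs → ∑ (λ s → f s + g s) xs ≡ ∑ f xs + ∑ g xs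
∑-+ f g []       = refl
∑-+ f g (s ∷ xs) = trans (cong (f s + g s +_) (∑-+ f g xs)) (interchange (f s) (g s) (∑ f xs) (∑ g xs))
  where
  interchange : ∀ a b c d → a + b + (c + d) ≡ a + c + (b + d)
  interchange = solve-∀

∑-* : ∀ m (f : A → ℕ) xs → ∑ (λ s → m * f s) xs ≡ m * ∑ f xs
∑-* m f []       = sym (*-zeroʳ m)
∑-* m f (s ∷ xs) = trans (cong (m * f s +_) (∑-* m f xs)) (sym (*-distribˡ-+ m (f s) (∑ f xs)))

∑-bound : ∀ {f : A → ℕ} {b} xs → (∀ {s} → s ∈ᴸ xs → f s ≤ b) → ∑ f xs ≤ length xs * b
∑-bound []       f≤b = z≤n
∑-bound (s ∷ xs) f≤b = +-mono-≤ (f≤b (here refl)) (∑-bound xs (f≤b ∘ there))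

∈⇒≤∑ : ∀ (f : A → ℕ) {s xs} → s ∈ᴸ xs → f s ≤ ∑ f xs
∈⇒≤∑ f (here refl) = m≤m+n _ _
∈⇒≤∑ f (there s∈)  = ≤-trans (∈⇒≤∑ f s∈) (m≤n+m _ _)

Unique-++⇒≢ : ∀ (xs : List A) {ys s t} → Unique (xs ++ ys) → s ∈ᴸ xs → t ∈ᴸ ys → s ≢ t
Unique-++⇒≢ (_ ∷ xs) (s≢ ∷ u) (here refl) t∈ = All.lookup s≢ (∈-++⁺ʳ xs t∈)
Unique-++⇒≢ (_ ∷ xs) (_ ∷ u)  (there s∈)  t∈ = Unique-++⇒≢ xs u s∈ t∈

∑-≟≤1 : ∀ (w : Fin n) {xs} → Unique xs → ∑ (λ s → ⟦ s ≟ w ⟧) xs ≤ 1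
∑-≟≤1 w []                = z≤n
∑-≟≤1 w {s ∷ xs} (s≢ ∷ u) with s ≟ w
... | no _     = ∑-≟≤1 w u
... | yes refl = s≤s (≤-trans
  (∑-bound xs λ {t} t∈ → ≤-reflexive (⟦⟧≡0 (t ≟ w) (All.lookup s≢ t∈ ∘ sym)))
  (≤-reflexive (*-zeroʳ (length xs))))

-- Turns degrees into sums over vertices, which can then be taken along any order of them.
∣comprehension∣≡∑ : ∀ {Pr : Fin n → Set} (Pr? : ∀ i → Dec (Pr i)) →
                    ∣ comprehension Pr? ∣ ≡ ∑ (λ i → ⟦ Pr? i ⟧) (allFin n)
∣comprehension∣≡∑ Pr? = trans (go (does ∘ Pr?)) (cong sum (sym (map-tabulate (λ i → i) (λ i → ⟦ Pr? i ⟧))))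
  where
  go : ∀ {m} (b : Fin m → Bool) → ∣ tabulate b ∣ ≡ sum (List.tabulate (λ i → if b i then 1 else 0))
  go {zero}  b = refl
  go {suc m} b with b zero
  ... | true  = cong suc (go (b ∘ suc))
  ... | false = go (b ∘ suc)

-- While no maximiser is found, `f` can be increased, and `k` bounds the increases still possible.
-- The double negation avoids having to decide whether a value is maximal.
¬¬-maximiser : (f : A → ℕ) (b : ℕ) → (∀ a → f a ≤ b) → A → ¬ ¬ (∃ λ a → ∀ a′ → f a′ ≤ f a)
¬¬-maximiser {A} f b f≤b a₀ ∄max = go b a₀ (m≤n+m b (f a₀))
  where
  go : ∀ k a → b ≤ f a + k → _
  go zero    a b≤ = ∄max (a , λ a′ → ≤-trans (f≤b a′) (subst (b ≤_) (+-identityʳ (f a)) b≤))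
  go (suc k) a b≤ = ∄max (a , λ a′ → ≮⇒≥ λ fa<fa′ →
    go k a′ (≤-trans b≤ (≤-trans (≤-reflexive (+-suc (f a) k)) (+-monoˡ-≤ k fa<fa′))))

-- Linear arrangements

module _ (c : A → A → ℕ) where

  total : List A → ℕ
  total []       = 0
  total (v ∷ vs) = ∑ (c v) vs + total vs

  total-bound : ∀ {b} → (∀ u v → c u v ≤ b) → ∀ m vs → length vs ≤ m → total vs ≤ m * (m * b)
  total-bound         c≤b m       []       _           = z≤n
  total-bound {b} c≤b (suc m) (v ∷ vs) (s≤s |vs|≤m) = +-mono-≤
    (≤-trans (∑-bound vs λ {s} _ → c≤b v s) (*-monoˡ-≤ b (m≤n⇒m≤1+n |vs|≤m)))
    (≤-trans (total-bound c≤b m vs |vs|≤m) (*-monoʳ-≤ m (*-monoˡ-≤ b (n≤1+n m))))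

  -- Moving `z` to the front of `S` reverses only the pairs made of `z` and an element of `S`. Both
  -- sides are sums because there is no subtraction.
  total-move : ∀ P S z Q →
    total (P ++ S ++ z ∷ Q) + ∑ (c z) S ≡ total (P ++ z ∷ S ++ Q) + ∑ (λ s → c s z) S
  total-move (v ∷ P) S z Q = begin
    ∑ (c v) (P ++ S ++ z ∷ Q) + total (P ++ S ++ z ∷ Q) + ∑ (c z) S
      ≡⟨ +-assoc (∑ (c v) (P ++ S ++ z ∷ Q)) _ _ ⟩
    ∑ (c v) (P ++ S ++ z ∷ Q) + (total (P ++ S ++ z ∷ Q) + ∑ (c z) S)
      ≡⟨ cong₂ _+_ (∑-↭ (c v) (++⁺ˡ P (shift z S Q))) (total-move P S z Q) ⟩
    ∑ (c v) (P ++ z ∷ S ++ Q) + (total (P ++ z ∷ S ++ Q) + ∑ (λ s → c s z) S)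
      ≡⟨ +-assoc (∑ (c v) (P ++ z ∷ S ++ Q)) _ _ ⟨
    ∑ (c v) (P ++ z ∷ S ++ Q) + total (P ++ z ∷ S ++ Q) + ∑ (λ s → c s z) S ∎
    where open ≡-Reasoning
  total-move [] []      z Q = refl
  total-move [] (s ∷ S) z Q = begin
    ∑ (c s) (S ++ z ∷ Q) + total (S ++ z ∷ Q) + (c z s + ∑ (c z) S)
      ≡⟨ regroup (∑ (c s) (S ++ z ∷ Q)) (total (S ++ z ∷ Q)) (c z s) (∑ (c z) S) ⟩
    ∑ (c s) (S ++ z ∷ Q) + c z s + (total (S ++ z ∷ Q) + ∑ (c z) S)
      ≡⟨ cong₂ (λ a b → a + c z s + b) (∑-↭ (c s) (shift z S Q)) (total-move [] S z Q) ⟩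
    c s z + ∑ (c s) (S ++ Q) + c z s + (∑ (c z) (S ++ Q) + total (S ++ Q) + ∑ (λ t → c t z) S)
      ≡⟨ regroup′ (c s z) (∑ (c s) (S ++ Q)) (c z s) (∑ (c z) (S ++ Q)) (total (S ++ Q)) (∑ (λ t → c t z) S) ⟩
    c z s + ∑ (c z) (S ++ Q) + (∑ (c s) (S ++ Q) + total (S ++ Q)) + (c s z + ∑ (λ t → c t z) S) ∎
    where
    open ≡-Reasoning
    regroup : ∀ a b c d → a + b + (c + d) ≡ a + c + (b + d)
    regroup = solve-∀
    regroup′ : ∀ a b c d e f → a + b + c + (d + e + f) ≡ c + d + (b + e) + (a + f)
    regroup′ = solve-∀

  Optimal : List A → Set
  Optimal L = ∀ L′ → L′ ↭ L → total L′ ≤ total L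

  -- The feedback property of median orders: moving `z` to the front of `S` cannot raise the total.
  optimal-feedback : ∀ P S z Q → Optimal (P ++ S ++ z ∷ Q) → ∑ (c z) S ≤ ∑ (λ s → c s z) S
  optimal-feedback P S z Q opt = +-cancelˡ-≤ (total (P ++ S ++ z ∷ Q)) _ _ (begin
    total (P ++ S ++ z ∷ Q) + ∑ (c z) S           ≡⟨ total-move P S z Q ⟩
    total (P ++ z ∷ S ++ Q) + ∑ (λ s → c s z) S   ≤⟨ +-monoˡ-≤ _ (opt _ (++⁺ˡ P (↭-sym (shift z S Q)))) ⟩
    total (P ++ S ++ z ∷ Q) + ∑ (λ s → c s z) S   ∎)
    where open ≤-Reasoning

  ¬¬-optimal : ∀ {b} → (∀ u v → c u v ≤ b) → ∀ vs → ¬ ¬ (∃ λ L → L ↭ vs × Optimal L)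
  ¬¬-optimal {b} c≤b vs k = ¬¬-maximiser {A = ∃ (_↭ vs)} (total ∘ proj₁) _
    (λ (L , L↭) → total-bound c≤b (length vs) L (≤-reflexive (↭-length L↭)))
    (vs , ↭-refl)
    (λ ((L , L↭) , max) → k (L , L↭ , λ L′ L′↭ → max (L′ , ↭-trans L′↭ L↭)))

-- Median orders

module MedianOrder {_⇒_ : Rel (Fin n) 0ℓ} (_⇒?_ : Decidable _⇒_) {x y : Fin n} (x≢y : x ≢ y) where

  -- The tie-breaking rule between median orders: suc n for y before x outweighs the change,
  -- at most n, of the positions of x and y when one vertex is moved.
  bonus : Fin n → Fin n → ℕ
  bonus u v with v ≟ x | v ≟ y | u ≟ y
  ... | yes _ | _     | yes _ = suc n
  ... | yes _ | _     | no _  = 1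
  ... | no _  | yes _ | _     = 1
  ... | no _  | no _  | _     = 0

  bonus≤ : ∀ u v → bonus u v ≤ suc n
  bonus≤ u v with v ≟ x | v ≟ y | u ≟ y
  ... | yes _ | _     | yes _ = ≤-refl
  ... | yes _ | _     | no _  = s≤s z≤n
  ... | no _  | yes _ | _     = s≤s z≤n
  ... | no _  | no _  | _     = z≤n

  bonus-y : ∀ u → bonus u y ≤ 1
  bonus-y u with y ≟ x | y ≟ y | u ≟ y
  ... | yes y≡x | _       | _ = contradiction (sym y≡x) x≢y
  ... | no _    | yes _   | _ = ≤-refl
  ... | no _    | no y≢y  | _ = z≤n

  bonus-yx : bonus y x ≡ suc n
  bonus-yx with x ≟ x | x ≟ y | y ≟ y
  ... | yes _   | _ | yes _  = refl
  ... | no x≢x  | _ | _      = contradiction refl x≢x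
  ... | yes _   | _ | no y≢y = contradiction refl y≢y

  bonus-other : ∀ u {v} → v ≢ x → v ≢ y → bonus u v ≤ 0
  bonus-other u {v} v≢x v≢y with v ≟ x | v ≟ y | u ≟ y
  ... | yes v≡x | _       | _ = contradiction v≡x v≢x
  ... | no _    | yes v≡y | _ = contradiction v≡y v≢y
  ... | no _    | no _    | _ = z≤n

  bonus-x≥1 : ∀ u → 1 ≤ bonus u x
  bonus-x≥1 u with x ≟ x | x ≟ y | u ≟ y
  ... | yes _  | _ | yes _ = s≤s z≤n
  ... | yes _  | _ | no _  = ≤-refl
  ... | no x≢x | _ | _     = contradiction refl x≢x

  bonus-y≥1 : ∀ u → 1 ≤ bonus u y
  bonus-y≥1 u with y ≟ x | y ≟ y | u ≟ y
  ... | yes y≡x | _      | _ = contradiction (sym y≡x) x≢y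
  ... | no _    | yes _  | _ = ≤-refl
  ... | no _    | no y≢y | _ = contradiction refl y≢y

  -- At most `n` pairs are reversed by a move and each bonus is at most `suc n`, so a single arc
  -- outweighs every change of bonus: `weight` compares arcs first and bonuses second.
  scale : ℕ
  scale = suc (n * suc n)

  weight : Fin n → Fin n → ℕ
  weight u v = scale * ⟦ u ⇒? v ⟧ + bonus u v

  weight≤ : ∀ u v → weight u v ≤ scale * 1 + suc n
  weight≤ u v = +-mono-≤ (*-monoʳ-≤ scale (⟦⟧≤1 (u ⇒? v))) (bonus≤ u v)

  outs ins : Fin n → List (Fin n) → ℕ
  outs z S = ∑ (λ s → ⟦ z ⇒? s ⟧) S
  ins  z S = ∑ (λ s → ⟦ s ⇒? z ⟧) S

  module _ P S z Q (L↭ : P ++ S ++ z ∷ Q ↭ allFin n) (opt : Optimal weight (P ++ S ++ z ∷ Q)) where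

    private
      out in′ : ℕ
      out = ∑ (bonus z) S
      in′ = ∑ (λ s → bonus s z) S

      weighted : scale * outs z S + out ≤ scale * ins z S + in′
      weighted = subst₂ _≤_
        (trans (∑-+ _ _ S) (cong (_+ out) (∑-* scale _ S)))
        (trans (∑-+ _ _ S) (cong (_+ in′) (∑-* scale _ S)))
        (optimal-feedback weight P S z Q opt)

      ∣S∣≤n : length S ≤ n
      ∣S∣≤n = begin
        length S                          ≤⟨ m≤m+n _ _ ⟩
        length S + length (z ∷ Q)         ≡⟨ length-++ S ⟨
        length (S ++ z ∷ Q)               ≤⟨ m≤n+m _ _ ⟩
        length P + length (S ++ z ∷ Q)    ≡⟨ length-++ P ⟨
        length (P ++ S ++ z ∷ Q)          ≡⟨ ↭-length L↭ ⟩
        length (allFin n)                 ≡⟨ length-tabulate (λ i → i) ⟩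
        n                                 ∎
        where open ≤-Reasoning

      unique : Unique (P ++ S ++ z ∷ Q)
      unique = ↭ₛ.Unique-resp-↭ (setoid _) (↭⇒↭ₛ (↭-sym L↭)) (allFin⁺ n)

      -- If the move improves the bonus, optimality forces it to lose at least one forward arc.
      bonus⇒< : in′ < out → outs z S < ins z S
      bonus⇒< in<out = *-cancelˡ-< scale _ _ (+-cancelʳ-< out _ _ (≤-<-trans weighted (+-monoʳ-< _ in<out)))

    feedback : outs z S ≤ ins z S
    feedback = ≤-pred (*-cancelˡ-< scale _ _ (begin-strict
      scale * outs z S               ≤⟨ m≤m+n _ _ ⟩
      scale * outs z S + out         ≤⟨ weighted ⟩
      scale * ins z S + in′          <⟨ +-monoʳ-< (scale * ins z S) in<scale ⟩
      scale * ins z S + scale        ≡⟨ +-comm _ scale ⟩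
      scale + scale * ins z S        ≡⟨ *-suc scale (ins z S) ⟨
      scale * suc (ins z S)          ∎))
      where
      open ≤-Reasoning
      in<scale : in′ < scale
      in<scale = s≤s (≤-trans (∑-bound S λ {s} _ → bonus≤ s z) (*-monoˡ-≤ (suc n) ∣S∣≤n))

    private
      -- Moving any vertex other than `x` and `y` costs no bonus, while the vertex `w` that it jumps
      -- over comes one place later.
      strict-other : ∀ {w} → w ∈ᴸ S → 1 ≤ bonus z w → z ≢ x → z ≢ y → outs z S < ins z S
      strict-other w∈S 1≤ z≢x z≢y = bonus⇒< (≤-<-trans
        (∑-bound S λ {s} _ → bonus-other s z≢x z≢y)
        (≤-trans (s≤s (≤-reflexive (*-zeroʳ (length S)))) (≤-trans 1≤ (∈⇒≤∑ (bonus z) w∈S))))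

    feedback-y : y ∈ᴸ S → z ≢ x → z ≢ y → outs z S < ins z S
    feedback-y y∈S = strict-other y∈S (bonus-y≥1 z)

    -- For `z = y` the move puts `y` before `x` and gains `suc n`, whereas the position of `y` drops
    -- by at most `n`.
    feedback-x : x ∈ᴸ S → z ≢ x → outs z S < ins z S
    feedback-x x∈S z≢x with z ≟ y
    ... | no z≢y   = strict-other x∈S (bonus-x≥1 z) z≢x z≢y
    ... | yes refl = bonus⇒< (begin-strict
      in′            ≤⟨ ∑-bound S (λ {s} _ → bonus-y s) ⟩
      length S * 1   ≡⟨ *-identityʳ _ ⟩
      length S       <⟨ s≤s ∣S∣≤n ⟩
      suc n          ≡⟨ bonus-yx ⟨
      bonus y x      ≤⟨ ∈⇒≤∑ (bonus y) x∈S ⟩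
      out            ∎)
      where open ≤-Reasoning

-- Completions of oriented graphs

module _ (D : OrientedGraph n) where
  open OrientedGraph D

  Missing : Rel (Fin n) 0ℓ
  Missing u v = u ≢ v × ¬ Adjacent u v

  missing? : Decidable Missing
  missing? u v = ¬? (u ≟ v) ×-dec ¬? ((u ⟶? v) ⊎-dec (v ⟶? u))

  Missing-sym : ∀ {u v} → Missing u v → Missing v u
  Missing-sym (u≢v , ¬adj) = u≢v ∘ sym , ¬adj ∘ Sum.swap

  -- Says that `z` lies outside the first and second out-neighbourhoods of `v`. The case `v = z`
  -- needs no separate clause, since without digons there is no closed path of length two.
  Misses : Rel (Fin n) 0ℓ
  Misses v z = ¬ (v ⟶ z) × ¬ (∃[ u ] (v ⟶ u × u ⟶ z))

  misses? : Decidable Misses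
  misses? v z = ¬? (v ⟶? z) ×-dec ¬? (any? λ u → (v ⟶? u) ×-dec (u ⟶? z))

  -- For a missing edge uz, this says that the orientation (u , z) is not convenient.
  Obstructed : Rel (Fin n) 0ℓ
  Obstructed u z = ∃[ v ] (v ⟶ u × Misses v z)

  obstructed? : Decidable Obstructed
  obstructed? u z = any? λ v → (v ⟶? u) ×-dec misses? v z

  -- An arc between `v` and `w`, in either direction, would complete one of the two forbidden paths
  -- of length two. The hypotheses are those under which `vw` loses to `uz`.
  obstructions-missing : ∀ {u z v w} → v ⟶ u → Misses v z → w ⟶ z → Misses w u → Missing v w
  obstructions-missing v⟶u (v↛z , v↛↛z) w⟶z (w↛u , w↛↛u) =
    (λ { refl → v↛z w⟶z }) ,
    [ (λ v⟶w → v↛↛z (_ , v⟶w , w⟶z)) , (λ w⟶v → w↛↛u (_ , w⟶v , v⟶u)) ]′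

  record TwoCover (x y : Fin n) : Set where
    field
      x⟶y      : x ⟶ y
      cover    : ∀ {u v} → Missing u v → (u ≡ x ⊎ u ≡ y) ⊎ (v ≡ x ⊎ v ≡ y)
      disjoint : ∀ {u} → Missing u x → ¬ Missing u y

module Completion (D : OrientedGraph n) {x y : Fin n} (xy : TwoCover D x y) where
  open OrientedGraph D
  open TwoCover xy

  x≢y : x ≢ y
  x≢y refl = noLoop x⟶y

  infix 4 _⇒_ _⇒?_

  -- A missing edge gets its convenient orientations, possibly both; if it has none, it
  -- is oriented towards x or y.
  _⇒_ : Rel (Fin n) 0ℓ
  u ⇒ z = u ⟶ z ⊎
    (Missing D u z × (¬ Obstructed D u z ⊎ (Obstructed D z u × (z ≡ x ⊎ z ≡ y))))

  _⇒?_ : Decidable _⇒_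
  u ⇒? z = (u ⟶? z) ⊎-dec
    (missing? D u z ×-dec (¬? (obstructed? D u z) ⊎-dec (obstructed? D z u ×-dec ((z ≟ x) ⊎-dec (z ≟ y)))))

  -- If both orientations of a missing edge are obstructed, one of its ends is a centre by `cover`,
  -- and the edge points there.
  ⇒-total : ∀ {u z} → u ≢ z → ¬ (u ⇒ z) → z ⇒ u
  ⇒-total {u} {z} u≢z u⇏z with u ⟶? z | z ⟶? u
  ... | yes u⟶z | _       = contradiction (inj₁ u⟶z) u⇏z
  ... | no _    | yes z⟶u = inj₁ z⟶u
  ... | no u↛z  | no z↛u  = inj₂ (Missing-sym D uz , oriented)
    where
    uz : Missing D u z
    uz = u≢z , [ u↛z , z↛u ]′
    oriented : ¬ Obstructed D z u ⊎ (Obstructed D u z × (u ≡ x ⊎ u ≡ y))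
    oriented with obstructed? D z u | obstructed? D u z | cover uz
    ... | no ¬zu | _      | _             = inj₁ ¬zu
    ... | yes zu | no ¬uz | _             = contradiction (inj₂ (uz , inj₁ ¬uz)) u⇏z
    ... | yes zu | yes ob | inj₁ u-centre = inj₂ (ob , u-centre)
    ... | yes zu | yes ob | inj₂ z-centre = contradiction (inj₂ (uz , inj₂ (zu , z-centre))) u⇏z

  ⟶⇒⇏ : ∀ {u z} → u ⟶ z → ¬ (z ⇒ u)
  ⟶⇒⇏ u⟶z (inj₁ z⟶u)             = noDigon u⟶z z⟶u
  ⟶⇒⇏ u⟶z (inj₂ ((_ , ¬adj) , _)) = ¬adj (inj₂ u⟶z)

  -- At distance 2 from f along ⇒ but not in D, there is at most one vertex: x if f = y,
  -- and y otherwise.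
  data Lost (f u : Fin n) : Fin n → Set where
    lost-x : f ≡ y → Lost f u x
    lost-y : f ≢ x → f ≢ y → u ⟶ x → Lost f u y

  -- If `D` has no path of length two from `f` to `s`, then `f` itself obstructs `us`, so `s` is a
  -- centre and some `w` obstructs `su`. Then `fw` is a missing edge, and `cover` leaves one case
  -- for each centre.
  second-or-lost : ∀ {f u s} → f ⟶ u → u ⇒ s → ¬ (f ⟶ s) → f ≢ s →
                   AtDistance2 f s ⊎ Lost f u s
  second-or-lost {f} {u} {s} f⟶u u⇒s f↛s f≢s with any? (λ v → (f ⟶? v) ×-dec (v ⟶? s)) | u⇒s
  ... | yes path | _ = inj₁ (f≢s , f↛s , path)
  ... | no f↛↛s  | inj₁ u⟶s = contradiction (u , f⟶u , u⟶s) f↛↛s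
  ... | no f↛↛s  | inj₂ (_ , inj₁ ¬obs) = contradiction (f , f⟶u , f↛s , f↛↛s) ¬obs
  ... | no f↛↛s  | inj₂ (us , inj₂ ((w , w⟶s , w-misses) , s-centre)) =
    inj₂ (lost s-centre us f↛s w⟶s w-misses fw)
    where
    fw : Missing D f w
    fw = obstructions-missing D f⟶u (f↛s , f↛↛s) w⟶s w-misses
    lost : ∀ {s} → s ≡ x ⊎ s ≡ y → Missing D u s → ¬ (f ⟶ s) → w ⟶ s → Misses D w u →
           Missing D f w → Lost f u s
    lost (inj₁ refl) us f↛s w⟶s w-misses fw with cover fw
    ... | inj₁ (inj₁ refl) = contradiction (inj₂ f⟶u) (proj₂ us)
    ... | inj₁ (inj₂ refl) = lost-x refl
    ... | inj₂ (inj₁ refl) = contradiction w⟶s noLoop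
    ... | inj₂ (inj₂ refl) = contradiction w⟶s (noDigon x⟶y)
    lost (inj₂ refl) us f↛s w⟶s w-misses fw with cover fw
    ... | inj₁ (inj₁ refl) = contradiction x⟶y f↛s
    ... | inj₁ (inj₂ refl) = contradiction (inj₂ f⟶u) (proj₂ us)
    ... | inj₂ (inj₂ refl) = contradiction w⟶s noLoop
    ... | inj₂ (inj₁ refl) = lost-y (proj₁ fw) (λ { refl → proj₂ us (inj₂ f⟶u) }) u⟶x
      where
      -- The vertex `u` already misses an edge to `y`, hence is adjacent to `x`; as `x` misses `u`,
      -- the arc enters `x`.
      u⟶x : u ⟶ x
      u⟶x with u ⟶? x | x ⟶? u
      ... | yes u⟶x | _       = u⟶x
      ... | no _    | yes x⟶u = contradiction x⟶u (proj₁ w-misses)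
      ... | no u↛x  | no x↛u  = contradiction us
        (disjoint ((λ { refl → proj₂ us (inj₁ x⟶y) }) , [ u↛x , x↛u ]′))

  open MedianOrder _⇒?_ x≢y

  out second : Fin n → Fin n → ℕ
  out    f s = ⟦ f ⟶? s ⟧
  second f s = ⟦ atDistance2? f s ⟧

  -- Segments of an optimal order

  module _ (L : List (Fin n)) (L↭ : L ↭ allFin n) (optimal : Optimal weight L)
           (I : List (Fin n)) (f : Fin n) (L≡ : L ≡ I ++ [ f ]) where

    unique : Unique L
    unique = ↭ₛ.Unique-resp-↭ (setoid _) (↭⇒↭ₛ (↭-sym L↭)) (allFin⁺ n)

    -- The first step is an arc of `D`, the second may be any arc of the completion.
    Reached : List (Fin n) → Fin n → Set
    Reached P s = f ⟶ s ⊎ Any (λ u → f ⟶ u × u ⇒ s) P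

    reached? : ∀ P s → Dec (Reached P s)
    reached? P s = (f ⟶? s) ⊎-dec Any.any? (λ u → (f ⟶? u) ×-dec (u ⇒? s)) P

    Reached-++ : ∀ {P s} Q → Reached P s → Reached (P ++ Q) s
    Reached-++ Q = Sum.map₂ (Any.++⁺ˡ {ys = Q})

    module Segment P S z Q (L≡PSzQ : L ≡ P ++ S ++ z ∷ Q) (f∈zQ : f ∈ᴸ z ∷ Q)
                   (reached : All (Reached (P ++ S)) S)
                   (end : z ≡ f ⊎ ¬ Reached (P ++ S) z) where

      L≡[PS]zQ : L ≡ (P ++ S) ++ z ∷ Q
      L≡[PS]zQ = trans L≡PSzQ (sym (++-assoc P S (z ∷ Q)))

      PS≢zQ : ∀ {s t} → s ∈ᴸ P ++ S → t ∈ᴸ z ∷ Q → s ≢ t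
      PS≢zQ = Unique-++⇒≢ (P ++ S) (subst Unique L≡[PS]zQ unique)

      ≢z : ∀ {s} → s ∈ᴸ P ++ S → s ≢ z
      ≢z s∈ = PS≢zQ s∈ (here refl)

      S⇒PS : ∀ {s} → s ∈ᴸ S → s ∈ᴸ P ++ S
      S⇒PS = ∈-++⁺ʳ P

      ⇏z : ∀ {s} → s ∈ᴸ P ++ S → f ⟶ s → ¬ (s ⇒ z)
      ⇏z {s} s∈ f⟶s s⇒z =
        [ (λ z≡f → ⟶⇒⇏ f⟶s (subst (s ⇒_) z≡f s⇒z))
        , (λ z-unreached → z-unreached (inj₂ (lose s∈ (f⟶s , s⇒z)))) ]′ end

      out≤outs : ∑ (out f) S ≤ outs z S
      out≤outs = ∑-mono S λ {s} s∈ → ⟦⟧-mono (f ⟶? s) (z ⇒? s) λ f⟶s →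
        ⇒-total (≢z (S⇒PS s∈)) (⇏z (S⇒PS s∈) f⟶s)

      L↭′ : P ++ S ++ z ∷ Q ↭ allFin n
      L↭′ = subst (_↭ allFin n) L≡PSzQ L↭

      optimal′ : Optimal weight (P ++ S ++ z ∷ Q)
      optimal′ = subst (Optimal weight) L≡PSzQ optimal

      f≢S : ∀ {s} → s ∈ᴸ S → f ≢ s
      f≢S s∈ = PS≢zQ (S⇒PS s∈) f∈zQ ∘ sym

      classify : ∀ {s} → s ∈ᴸ S → ¬ (f ⟶ s) →
                 AtDistance2 f s ⊎ ∃[ u ] (u ∈ᴸ P ++ S × f ⟶ u × Lost f u s)
      classify s∈ f↛s with All.lookup reached s∈
      ... | inj₁ f⟶s = contradiction f⟶s f↛s
      ... | inj₂ path with find path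
      ...   | u , u∈ , f⟶u , u⇒s =
        Sum.map₂ (λ lost → u , u∈ , f⟶u , lost) (second-or-lost f⟶u u⇒s f↛s (f≢S s∈))

      -- In-neighbours of `z` are not out-neighbours of `f`, and `w` occurs at most once in the
      -- order. Strict feedback will pay for the extra 1.
      ins≤ : ∀ w → (∀ {s} → s ∈ᴸ S → ¬ (f ⟶ s) → AtDistance2 f s ⊎ s ≡ w) →
             ins z S ≤ ∑ (second f) S + 1
      ins≤ w second-or-w = begin
        ins z S                                   ≤⟨ ∑-mono S pointwise ⟩
        ∑ (λ s → second f s + ⟦ s ≟ w ⟧) S        ≡⟨ ∑-+ _ _ S ⟩
        ∑ (second f) S + ∑ (λ s → ⟦ s ≟ w ⟧) S    ≤⟨ +-monoʳ-≤ (∑ (second f) S) w≤1 ⟩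
        ∑ (second f) S + 1                        ∎
        where
        open ≤-Reasoning
        pointwise : ∀ {s} → s ∈ᴸ S → ⟦ s ⇒? z ⟧ ≤ second f s + ⟦ s ≟ w ⟧
        pointwise {s} s∈ = ⟦⟧-⊎ (s ⇒? z) (atDistance2? f s) (s ≟ w) λ s⇒z →
          second-or-w s∈ λ f⟶s → ⇏z (S⇒PS s∈) f⟶s s⇒z
        w≤1 : ∑ (λ s → ⟦ s ≟ w ⟧) S ≤ 1
        w≤1 = begin
          ∑ (λ s → ⟦ s ≟ w ⟧) S                       ≤⟨ m≤m+n _ _ ⟩
          _                                           ≡⟨ ∑-++ _ S (z ∷ Q) ⟨
          ∑ (λ s → ⟦ s ≟ w ⟧) (S ++ z ∷ Q)            ≤⟨ m≤n+m _ _ ⟩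
          _                                           ≡⟨ ∑-++ _ P (S ++ z ∷ Q) ⟨
          ∑ (λ s → ⟦ s ≟ w ⟧) (P ++ S ++ z ∷ Q)       ≤⟨ ∑-≟≤1 w (subst Unique L≡PSzQ unique) ⟩
          1                                           ∎

      balanced-if-lost : ∀ {u w} → w ∈ᴸ S → u ∈ᴸ P ++ S → f ⟶ u → Lost f u w →
                         ∑ (out f) S ≤ ∑ (second f) S
      balanced-if-lost {w = w} w∈ u∈ f⟶u lost = ≤-pred (begin
        suc (∑ (out f) S)       ≤⟨ s≤s out≤outs ⟩
        suc (outs z S)          ≤⟨ strict w∈ lost ⟩
        ins z S                 ≤⟨ ins≤ w (λ s∈ f↛s → Sum.map₂ only-w (classify s∈ f↛s)) ⟩
        ∑ (second f) S + 1      ≡⟨ +-comm _ 1 ⟩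
        suc (∑ (second f) S)    ∎)
        where
        open ≤-Reasoning hiding (strict)
        -- Which centre can be lost depends on `f` alone, so a segment loses at most one vertex.
        same : ∀ {u u′ s t} → Lost f u s → Lost f u′ t → s ≡ t
        same (lost-x _)       (lost-x _)       = refl
        same (lost-x f≡y)     (lost-y _ f≢y _) = contradiction f≡y f≢y
        same (lost-y _ f≢y _) (lost-x f≡y)     = contradiction f≡y f≢y
        same (lost-y _ _ _)   (lost-y _ _ _)   = refl
        only-w : ∀ {s} → ∃[ u ] (u ∈ᴸ P ++ S × f ⟶ u × Lost f u s) → s ≡ w
        only-w (_ , _ , _ , lost′) = same lost′ lost
        strict : ∀ {w} → w ∈ᴸ S → Lost f _ w → outs z S < ins z S
        strict x∈ (lost-x _) = feedback-x P S z Q L↭′ optimal′ x∈ (≢z (S⇒PS x∈) ∘ sym)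
        strict y∈ (lost-y f≢x _ u⟶x) = feedback-y P S z Q L↭′ optimal′ y∈ z≢x (≢z (S⇒PS y∈) ∘ sym)
          where
          -- The arc from `u` to `x` stored in `lost-y` makes `x` reached, so `x` cannot close this
          -- segment.
          z≢x : z ≢ x
          z≢x z≡x =
            [ (λ z≡f → f≢x (trans (sym z≡f) z≡x))
            , (λ z-unreached → z-unreached
                (inj₂ (lose u∈ (f⟶u , inj₁ (subst (_ ⟶_) (sym z≡x) u⟶x))))) ]′ end

      balanced : ∑ (out f) S ≤ ∑ (second f) S
      balanced with Any.any? (λ s → ¬? (f ⟶? s) ×-dec ¬? (atDistance2? f s)) S
      ... | no ∄lost = ≤-trans out≤outs (≤-trans (feedback P S z Q L↭′ optimal′)
        (∑-mono S λ {s} s∈ → ⟦⟧-mono (s ⇒? z) (atDistance2? f s) λ s⇒z →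
          decidable-stable (atDistance2? f s) λ ¬second →
            ∄lost (lose s∈ ((λ f⟶s → ⇏z (S⇒PS s∈) f⟶s s⇒z) , ¬second))))
      ... | yes ∃lost with find ∃lost
      ...   | w , w∈ , f↛w , ¬second with classify w∈ f↛w
      ...     | inj₁ second             = contradiction second ¬second
      ...     | inj₂ (u , u∈ , f⟶u , lost) = balanced-if-lost w∈ u∈ f⟶u lost

    private
      out-sum : List (Fin n) → List (Fin n) → ℕ → ℕ
      out-sum P S o = ∑ (out f) P + (∑ (out f) S + (o + 0))

    -- `P` consists of the closed segments with their closing vertices, and `S` is the open segment.
    -- A reached vertex extends `S`; any other vertex closes it.
    scan : ∀ P S Q → L ≡ P ++ S ++ Q ++ [ f ] → All (Reached (P ++ S)) S →
           ∑ (out f) P ≤ ∑ (second f) P → ∑ (out f) L ≤ ∑ (second f) L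
    scan P S [] L≡ reached P-balanced = begin
      ∑ (out f) L                                               ≡⟨ split (out f) ⟩
      ∑ (out f) P + (∑ (out f) S + (out f f + 0))               ≡⟨ cong (out-sum P S) (⟦⟧≡0 (f ⟶? f) noLoop) ⟩
      ∑ (out f) P + (∑ (out f) S + 0)                           ≤⟨ +-mono-≤ P-balanced (+-mono-≤ S-balanced z≤n) ⟩
      ∑ (second f) P + (∑ (second f) S + (second f f + 0))      ≡⟨ split (second f) ⟨
      ∑ (second f) L                                            ∎
      where
      open ≤-Reasoning
      S-balanced : ∑ (out f) S ≤ ∑ (second f) S
      S-balanced = Segment.balanced P S f [] L≡ (here refl) reached (inj₁ refl)
      split : ∀ h → ∑ h L ≡ ∑ h P + (∑ h S + (h f + 0))
      split h = trans (cong (∑ h) L≡) (trans (∑-++ h P _) (cong (∑ h P +_) (∑-++ h S _)))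
    scan P S (z ∷ Q) L≡ reached P-balanced with reached? (P ++ S) z
    ... | yes z-reached = scan P (S ++ [ z ]) Q
      (trans L≡ (cong (P ++_) (sym (++-assoc S [ z ] _))))
      (subst (λ R → All (Reached R) (S ++ [ z ])) (++-assoc P S [ z ])
        (All.++⁺ (All.map (Reached-++ [ z ]) reached) (Reached-++ [ z ] z-reached ∷ [])))
      P-balanced
    ... | no z-unreached = scan (P ++ S ++ [ z ]) [] Q
      (trans L≡ (sym (trans (++-assoc P _ _) (cong (P ++_) (++-assoc S [ z ] _)))))
      []
      (begin
        ∑ (out f) (P ++ S ++ [ z ])                            ≡⟨ split (out f) ⟩
        -- The closing vertex is not an out-neighbour of `f`, so it adds nothing on the left.
        ∑ (out f) P + (∑ (out f) S + (out f z + 0))            ≡⟨ cong (out-sum P S) (⟦⟧≡0 (f ⟶? z) (z-unreached ∘ inj₁)) ⟩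
        ∑ (out f) P + (∑ (out f) S + 0)                        ≤⟨ +-mono-≤ P-balanced (+-mono-≤ S-balanced z≤n) ⟩
        ∑ (second f) P + (∑ (second f) S + (second f z + 0))   ≡⟨ split (second f) ⟨
        ∑ (second f) (P ++ S ++ [ z ])                         ∎)
      where
      open ≤-Reasoning
      S-balanced : ∑ (out f) S ≤ ∑ (second f) S
      S-balanced = Segment.balanced P S z (Q ++ [ f ]) L≡ (there (∈-++⁺ʳ Q (here refl))) reached (inj₂ z-unreached)
      split : ∀ h → ∑ h (P ++ S ++ [ z ]) ≡ ∑ h P + (∑ h S + (h z + 0))
      split h = trans (∑-++ h P _) (cong (∑ h P +_) (∑-++ h S _))

    d⁺≤d⁺⁺ : d⁺ f ≤ d⁺⁺ f
    d⁺≤d⁺⁺ = begin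
      d⁺ f                          ≡⟨ ∣comprehension∣≡∑ (f ⟶?_) ⟩
      ∑ (out f) (allFin n)          ≡⟨ ∑-↭ (out f) L↭ ⟨
      ∑ (out f) L                   ≤⟨ scan [] [] I L≡ [] z≤n ⟩
      ∑ (second f) L                ≡⟨ ∑-↭ (second f) L↭ ⟩
      ∑ (second f) (allFin n)       ≡⟨ ∣comprehension∣≡∑ (atDistance2? f) ⟨
      d⁺⁺ f                         ∎
      where open ≤-Reasoning

  second-neighbourhood : ∃[ v ] (d⁺ v ≤ d⁺⁺ v)
  -- The conclusion is decidable, so an optimal order is needed only up to double negation.
  second-neighbourhood = decidable-stable (any? λ v → d⁺ v ≤? d⁺⁺ v) λ ∄v →
    ¬¬-optimal weight weight≤ (allFin n) λ (L , L↭ , optimal) → last ∄v L L↭ optimal (initLast L) refl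
    where
    last : ¬ (∃[ v ] (d⁺ v ≤ d⁺⁺ v)) → ∀ L → L ↭ allFin n → Optimal weight L →
           ∀ {L′} → List.InitLast L′ → L ≡ L′ → ⊥
    last ∄v L L↭ optimal List.[]        refl = Any.¬Any[] (∈-resp-↭ (↭-sym L↭) (∈-allFin x))
    last ∄v L L↭ optimal (I List.∷ʳ′ f) L≡   = ∄v (f , d⁺≤d⁺⁺ L L↭ optimal I f L≡)

-- From two disjoint stars to a cover

∈-pair⁻ : ∀ (a b : Fin n) {u} → u ∈ pair a b → u ≡ a ⊎ u ≡ b
∈-pair⁻ a b u∈ = Sum.map (x∈⁅y⁆⇒x≡y a) (x∈⁅y⁆⇒x≡y b) (x∈p∪q⁻ ⁅ a ⁆ ⁅ b ⁆ u∈)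

∈-pairˡ : ∀ (a b : Fin n) → a ∈ pair a b
∈-pairˡ a b = x∈p∪q⁺ (inj₁ (x∈⁅x⁆ a))

∈-pairʳ : ∀ (a b : Fin n) → b ∈ pair a b
∈-pairʳ a b = x∈p∪q⁺ {p = ⁅ a ⁆} (inj₂ (x∈⁅x⁆ b))

module _ (S : Star n) where
  open Star S

  center∈V : Graph.V graph center
  center∈V = x∈p∪q⁺ (inj₁ (x∈⁅x⁆ center))

  edge⊆V : ∀ {e u} → Graph.E graph e → u ∈ e → Graph.V graph u
  edge⊆V (a , a∈leaves , refl) u∈ with ∈-pair⁻ a center u∈
  ... | inj₁ refl = x∈p∪q⁺ (inj₂ a∈leaves)
  ... | inj₂ refl = center∈V

  edge-center : ∀ {u v} → Graph.E graph (pair u v) → u ≡ center ⊎ v ≡ center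
  edge-center {u} {v} (a , _ , uv≡) =
    Sum.map sym sym (∈-pair⁻ u v (subst (center ∈_) (sym uv≡) (∈-pairʳ a center)))

module TwoStars (D : OrientedGraph n) (S T : Star n)
                (S⊥T : ∀ {v} → ¬ (Graph.V (Star.graph S) v × Graph.V (Star.graph T) v))
                (edges : ∀ {e} → OrientedGraph.IsMissingEdge D e →
                         Graph.E (Star.graph S) e ⊎ Graph.E (Star.graph T) e) where
  open OrientedGraph D

  x y : Fin n
  x = Star.center S
  y = Star.center T

  edge : ∀ {u v} → Missing D u v → Graph.E (Star.graph S) (pair u v) ⊎ Graph.E (Star.graph T) (pair u v)
  edge (u≢v , ¬adj) = edges (_ , _ , refl , u≢v , ¬adj)

  cover : ∀ {u v} → Missing D u v → (u ≡ x ⊎ u ≡ y) ⊎ (v ≡ x ⊎ v ≡ y)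
  cover uv with edge uv
  ... | inj₁ uv∈S = Sum.map inj₁ inj₁ (edge-center S uv∈S)
  ... | inj₂ uv∈T = Sum.map inj₂ inj₂ (edge-center T uv∈T)

  -- An edge at `x` in the star `T` would make `x` a common vertex of the stars.
  missing-x⇒∈S : ∀ {u} → Missing D u x → Graph.V (Star.graph S) u
  missing-x⇒∈S {u} ux with edge ux
  ... | inj₁ ux∈S = edge⊆V S ux∈S (∈-pairˡ u x)
  ... | inj₂ ux∈T = contradiction (center∈V S , edge⊆V T ux∈T (∈-pairʳ u x)) S⊥T

  missing-y⇒∈T : ∀ {u} → Missing D u y → Graph.V (Star.graph T) u
  missing-y⇒∈T {u} uy with edge uy
  ... | inj₁ uy∈S = contradiction (edge⊆V S uy∈S (∈-pairʳ u y) , center∈V T) S⊥T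
  ... | inj₂ uy∈T = edge⊆V T uy∈T (∈-pairˡ u y)

  disjoint : ∀ {u} → Missing D u x → ¬ Missing D u y
  disjoint ux uy = S⊥T (missing-x⇒∈S ux , missing-y⇒∈T uy)

  x≢y : x ≢ y
  x≢y x≡y = S⊥T (center∈V S , subst (Graph.V (Star.graph T)) (sym x≡y) (center∈V T))

  snc : ∃[ v ] (d⁺ v ≤ d⁺⁺ v)
  snc with x ⟶? y | y ⟶? x
  ... | yes x⟶y | _ = Completion.second-neighbourhood D record
    { x⟶y = x⟶y ; cover = cover ; disjoint = disjoint }
  ... | no _ | yes y⟶x = Completion.second-neighbourhood D record
    { x⟶y = y⟶x ; cover = Sum.map Sum.swap Sum.swap ∘ cover ; disjoint = flip disjoint }
  -- Non-adjacent centres would form a missing edge, which would put `x` in both stars.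
  ... | no x↛y | no y↛x =
    contradiction (center∈V S , missing-y⇒∈T (x≢y , [ x↛y , y↛x ]′)) S⊥T

theorem4 : ∀ {n : ℕ} (D : OrientedGraph n) →
    MissingTwoDisjointStars D →
    (∀ e → ¬ DependencyDigraph.Isolated D e) →
    ∃[ v ] (OrientedGraph.d⁺ D v ≤ OrientedGraph.d⁺⁺ D v)
theorem4 D (S , T , S⊥T , _ , E⊆ , _) _ = TwoStars.snc D S T S⊥T E⊆
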